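{- Let $m\geq 1$ and $x\geq 1$ be natural numbers. Then: (i) if $x$ is not of the form $p^c-1$ for any prime $p$ dividing $m$ and any integer $c\geq 1$, then $\ell(m,x+1)=\ell(m,x)$; (ii) if $x=p^c-1$ for some prime $p$ dividing $m$ and some integer $c\geq 1$, then $\ell(m,x+1)=p\,\ell(m,x)$.
   Context: For natural numbers $m\geq 1$ and $x\geq 1$, $\ell(m,x)$ denotes the minimal period modulo $m$ of the sequence $n\mapsto\binom{n}{x}$, that is, the least non-zero natural number $\ell$ such that $\binom{n+\ell}{x}\equiv\binom{n}{x}\pmod m$ for all positive integers $n$, with the convention $\binom{n}{x}=0$ if $0\leq n<x$ and $\binom{n}{x}=\frac{n!}{x!(n-x)!}$ if $n\geq x$. The paper recalls as known that if $m=\prod_{i=1}^w p_i^{b_i}$ is the factorization of $m$ into powers of distinct primes ($b_i\geq 1$), then $\ell(m,x)=m\prod_{i=1}^w p_i^{\lfloor\log_{p_i}x\rfloor}$. -}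

module Defs where

open import Data.Nat
open import Data.Nat.Properties
open import Data.Nat.DivMod
open import Data.Nat.Divisibility using (m∣m*n)
open import Data.Nat.Combinatorics using (_C_; nCk+nC[k+1]≡[n+1]C[k+1])
open import Data.Nat.Induction using (<-rec)
open import Data.Product using (∃; _×_; _,_; proj₁; proj₂)
open import Relation.Nullary using (Dec; yes; no)
open import Relation.Nullary.Decidable using (map′; _×-dec_)
open import Relation.Unary using (Decidable)
open import Relation.Binary.PropositionalEquality

infix 4 _≡_[mod_]

_≡_[mod_] : ℕ → ℕ → (m : ℕ) → .{{NonZero m}} → Set
a ≡ b [mod m ] = a % m ≡ b % m

-- n C x is 0 when n < x.
IsPeriod : (m x ℓ : ℕ) → .{{NonZero m}} → Set
IsPeriod m x ℓ = ∀ n → 1 ≤ n → (n + ℓ) C x ≡ n C x [mod m ]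

record IsMinimalPeriod (m x ℓ : ℕ) .{{_ : NonZero m}} : Set where
  field
    positive : 1 ≤ ℓ
    isPeriod : IsPeriod m x ℓ
    minimal  : ∀ k → 1 ≤ k → IsPeriod m x k → ℓ ≤ k

-- The minimal period exists because m ^ x is a period, and being a period can
-- therefore be decided by inspecting the first m ^ x values.

private
  least : ∀ {P : ℕ → Set} → Decidable P → ∀ n → P n →
          ∃ λ l → P l × (∀ k → P k → l ≤ k)
  least {P} P? = <-rec _ step
    where
    step : ∀ n → (∀ {i} → i < n → P i → ∃ λ l → P l × (∀ k → P k → l ≤ k)) →
           P n → ∃ λ l → P l × (∀ k → P k → l ≤ k)
    step n rec Pn with anyUpTo? P? n
    ... | yes (i , i<n , Pi) = rec i<n Pi
    ... | no none = n , Pn , λ k Pk → ≮⇒≥ λ k<n → none (k , k<n , Pk)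

  module _ (m : ℕ) .{{_ : NonZero m}} where

    +-cong-mod : ∀ {a b c d} → a ≡ b [mod m ] → c ≡ d [mod m ] →
                 a + c ≡ b + d [mod m ]
    +-cong-mod {a} {b} {c} {d} a≡b c≡d = begin
      (a + c) % m             ≡⟨ %-distribˡ-+ a c m ⟩
      (a % m + c % m) % m     ≡⟨ cong₂ (λ u v → (u + v) % m) a≡b c≡d ⟩
      (b % m + d % m) % m     ≡⟨ %-distribˡ-+ b d m ⟨
      (b + d) % m             ∎
      where open ≡-Reasoning

    iterate-period : ∀ x L c → (∀ n → (n + L) C x ≡ n C x + c [mod m ]) →
                     ∀ j n → (n + j * L) C x ≡ n C x + j * c [mod m ]
    iterate-period x L c shift zero    n =
      cong (_% m) (trans (cong (_C x) (+-identityʳ n)) (sym (+-identityʳ (n C x))))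
    iterate-period x L c shift (suc j) n = begin
      ((n + (L + j * L)) C x) % m   ≡⟨ cong (λ k → (k C x) % m) (+-assoc n L (j * L)) ⟨
      ((n + L + j * L) C x) % m     ≡⟨ iterate-period x L c shift j (n + L) ⟩
      ((n + L) C x + j * c) % m     ≡⟨ +-cong-mod {c = j * c} (shift n) refl ⟩
      (n C x + c + j * c) % m       ≡⟨ cong (_% m) (+-assoc (n C x) c (j * c)) ⟩
      (n C x + (c + j * c)) % m     ∎
      where open ≡-Reasoning

    -- By Pascal's rule, shifting n by a period L of n C x changes n C (x + 1)
    -- by the constant L C (x + 1) modulo m.
    shift-suc : ∀ x L → (∀ n → (n + L) C x ≡ n C x [mod m ]) →
                ∀ n → (n + L) C suc x ≡ n C suc x + L C suc x [mod m ]
    shift-suc x L per zero    = refl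
    shift-suc x L per (suc n) = begin
      (suc (n + L) C suc x) % m
        ≡⟨ cong (_% m) (nCk+nC[k+1]≡[n+1]C[k+1] (n + L) x) ⟨
      ((n + L) C x + (n + L) C suc x) % m
        ≡⟨ +-cong-mod (per n) (shift-suc x L per n) ⟩
      (n C x + (n C suc x + L C suc x)) % m
        ≡⟨ cong (_% m) (+-assoc (n C x) _ _) ⟨
      (n C x + n C suc x + L C suc x) % m
        ≡⟨ cong (λ k → (k + L C suc x) % m) (nCk+nC[k+1]≡[n+1]C[k+1] n x) ⟩
      (suc n C suc x + L C suc x) % m ∎
      where open ≡-Reasoning

    m^x-period : ∀ x n → (n + m ^ x) C x ≡ n C x [mod m ]
    m^x-period zero    n = refl
    m^x-period (suc x) n =
      trans (iterate-period (suc x) (m ^ x) _ (shift-suc x (m ^ x) (m^x-period x)) m n)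
            (%-remove-+ʳ (n C suc x) (m∣m*n (m ^ x C suc x)))

    multiple-period : ∀ x j n → (n + j * m ^ x) C x ≡ n C x [mod m ]
    multiple-period x j n =
      trans (iterate-period x (m ^ x) 0
               (λ k → trans (m^x-period x k) (cong (_% m) (sym (+-identityʳ (k C x))))) j n)
            (cong (_% m) (trans (cong (n C x +_) (*-zeroʳ j)) (+-identityʳ (n C x))))

    isPeriod? : ∀ x ℓ → Dec (IsPeriod m x ℓ)
    isPeriod? x ℓ = map′ extend (λ per {n} _ → per (suc n) (s≤s z≤n))
      (allUpTo? (λ n → ((suc n + ℓ) C x) % m ≟ (suc n C x) % m) M)
      where
      M = m ^ x
      instance
        M≢0 : NonZero M
        M≢0 = m^n≢0 m x

      extend : (∀ {n} → n < M → (suc n + ℓ) C x ≡ suc n C x [mod m ]) →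
               IsPeriod m x ℓ
      extend bounded (suc n) _ = begin
        ((suc n + ℓ) C x) % m
          ≡⟨ cong (λ k → ((suc k + ℓ) C x) % m) (m≡m%n+[m/n]*n n M) ⟩
        ((suc (r + q * M) + ℓ) C x) % m
          ≡⟨ cong (λ k → (suc k C x) % m) (trans (+-assoc r (q * M) ℓ)
               (trans (cong (r +_) (+-comm (q * M) ℓ)) (sym (+-assoc r ℓ (q * M))))) ⟩
        ((suc r + ℓ + q * M) C x) % m
          ≡⟨ multiple-period x q (suc r + ℓ) ⟩
        ((suc r + ℓ) C x) % m
          ≡⟨ bounded (m%n<n n M) ⟩
        (suc r C x) % m
          ≡⟨ multiple-period x q (suc r) ⟨
        ((suc r + q * M) C x) % m
          ≡⟨ cong (λ k → (suc k C x) % m) (m≡m%n+[m/n]*n n M) ⟨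
        (suc n C x) % m ∎
        where
        open ≡-Reasoning
        r = n % M
        q = n / M

minimalPeriod : (m x : ℕ) .{{_ : NonZero m}} → ∃ λ l → IsMinimalPeriod m x l
minimalPeriod m x
  with l , (1≤l , per) , min ← least (λ l → (1 ≤? l) ×-dec isPeriod? m x l) (m ^ x)
                                (m^n>0 m x , λ n _ → m^x-period m x n)
  = l , record
    { positive = 1≤l
    ; isPeriod = per
    ; minimal  = λ k 1≤k perₖ → min k (1≤k , perₖ)
    }

ℓ : (m x : ℕ) .{{_ : NonZero m}} → ℕ
ℓ m x = proj₁ (minimalPeriod m x)

ℓ-isMinimalPeriod : ∀ m x .{{_ : NonZero m}} → IsMinimalPeriod m x (ℓ m x)
ℓ-isMinimalPeriod m x = proj₂ (minimalPeriod m x)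

{-# OPTIONS --safe #-}
-- By Pascal's rule, L is a period of n ↦ n C x modulo m iff m divides L C j for
-- 1 ≤ j ≤ x. For L = ℓ m x, shifting n by L changes n C (x + 1) by the constant
-- L C (x + 1), so ℓ m (x + 1) = d L with d the additive order of L C (x + 1)
-- modulo m. As (L C (x + 1)) ((x + 1) C j) is a multiple of L C j, this order
-- divides (x + 1) C j for all 1 ≤ j ≤ x. A prime dividing all of these numbers
-- forces x + 1 to be a power of it, and for x + 1 = p ^ c their common divisors
-- divide p. When moreover p ∣ m, the order is not 1: with b the prime-to-p part
-- of a common multiple of 1, …, x, the number m p ^ (c ∸ 1) b is a period for x
-- but not for x + 1.
module Submission where

open import Defs
open import Data.List using ([]; _∷_)
open import Data.List.Relation.Unary.All using (_∷_)
open import Data.Nat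
open import Data.Nat.Combinatorics
open import Data.Nat.Coprimality using (Coprime; coprime-divisor)
open import Data.Nat.DivMod
open import Data.Nat.Divisibility
open import Data.Nat.Induction using (<-rec)
open import Data.Nat.Primality
open import Data.Nat.Primality.Factorisation using (factorise; module PrimeFactorisation)
open import Data.Nat.Properties
open import Algebra.Properties.CommutativeSemigroup *-commutativeSemigroup
  using (x∙yz≈y∙xz; xy∙z≈y∙xz)
open import Data.Nat.Tactic.RingSolver using (solve-∀)
open import Data.Product using (_×_; _,_; proj₁; proj₂; ∃-syntax)
open import Data.Sum using (inj₁; inj₂)
open import Function using (case_of_)
open import Relation.Nullary using (¬_; yes; no; contradiction)
open import Relation.Binary.PropositionalEquality
  using (_≡_; _≢_; refl; sym; trans; cong; cong₂; subst; module ≡-Reasoning)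

-- Arithmetic and binomial identities.

private
  +-collect : ∀ a b c s t m → a + s * m + (b + c + t * m) ≡ a + b + c + (s + t) * m
  +-collect = solve-∀

  *-collect : ∀ k a s t m → k * a + s * m + a + t * m ≡ suc k * a + (s + t) * m
  *-collect = solve-∀

  *-swap : ∀ b m a c → b * (m * a * c) ≡ a * b * (c * m)
  *-swap = solve-∀

  *-regroup : ∀ m a p q → m * a * (p * q) ≡ p * a * (q * m)
  *-regroup = solve-∀

  *-reassoc : ∀ m a b u → m * (a * b) * u ≡ m * a * (b * u)
  *-reassoc = solve-∀

  *-rotate : ∀ q j c m → q * j * (c * m) ≡ j * (q * c * m)
  *-rotate = solve-∀

-- Multiplied out to avoid division; with `pred`, both sides are 0 at `n = 0`. Pascal's rule splits
-- the left side so that the hypothesis for the smaller `n` applies at both `k` and `suc k`.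
C-absorption : ∀ n k → suc k * (n C suc k) ≡ n * (pred n C k)
C-absorption zero          k       = *-zeroʳ (suc k)
C-absorption (suc zero)    zero    = refl
C-absorption (suc zero)    (suc k) = trans
  (cong (suc (suc k) *_) (k>n⇒nCk≡0 {1} {suc (suc k)} (s≤s (s≤s z≤n)))) (*-zeroʳ (suc (suc k)))
C-absorption (suc (suc n)) zero    = begin
  1 * (suc (suc n) C 1)  ≡⟨ *-identityˡ _ ⟩
  suc (suc n) C 1        ≡⟨ nC1≡n (suc (suc n)) ⟩
  suc (suc n)            ≡⟨ *-identityʳ _ ⟨
  suc (suc n) * 1        ∎
  where open ≡-Reasoning
C-absorption (suc n@(suc n′)) (suc k) = begin
  suc (suc k) * (suc n C suc (suc k))
    ≡⟨ cong (suc (suc k) *_) (nCk+nC[k+1]≡[n+1]C[k+1] n (suc k)) ⟨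
  suc (suc k) * (a + b)
    ≡⟨ *-distribˡ-+ (suc (suc k)) a b ⟩
  a + suc k * a + suc (suc k) * b
    ≡⟨ cong₂ (λ u v → a + u + v) (C-absorption n k) (C-absorption n (suc k)) ⟩
  a + n * (n′ C k) + n * (n′ C suc k)
    ≡⟨ +-assoc a _ _ ⟩
  a + (n * (n′ C k) + n * (n′ C suc k))
    ≡⟨ cong (a +_) (*-distribˡ-+ n (n′ C k) (n′ C suc k)) ⟨
  a + n * (n′ C k + n′ C suc k)
    ≡⟨ cong (λ u → a + n * u) (nCk+nC[k+1]≡[n+1]C[k+1] n′ k) ⟩
  suc n * a ∎
  where
  open ≡-Reasoning
  a = n C suc k
  b = n C suc (suc k)

-- For i ≤ k ≤ n the cofactor is (n - i) C (k - i); stating only divisibility avoids the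
-- subtractions. After multiplication by `suc i`, three absorptions reduce the claim to the
-- predecessors.
C∣C*C : ∀ n k i → n C i ∣ (n C k) * (k C i)
C∣C*C n       k       zero    = 1∣ _
C∣C*C n       zero    (suc i) = subst (n C suc i ∣_) (sym (*-zeroʳ (n C 0))) ((n C suc i) ∣0)
C∣C*C zero    (suc k) (suc i) = 0 ∣0
C∣C*C (suc n) (suc k) (suc i) = *-cancelˡ-∣ (suc i) (begin
  suc i * (suc n C suc i)                      ≡⟨ C-absorption (suc n) i ⟩
  suc n * (n C i)                              ∣⟨ *-monoʳ-∣ (suc n) (C∣C*C n k i) ⟩
  suc n * ((n C k) * (k C i))                  ≡⟨ *-assoc (suc n) (n C k) (k C i) ⟨
  suc n * (n C k) * (k C i)                    ≡⟨ cong (_* (k C i)) (C-absorption (suc n) k) ⟨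
  suc k * (suc n C suc k) * (k C i)            ≡⟨ xy∙z≈y∙xz (suc k) (suc n C suc k) (k C i) ⟩
  (suc n C suc k) * (suc k * (k C i))          ≡⟨ cong ((suc n C suc k) *_) (C-absorption (suc k) i) ⟨
  (suc n C suc k) * (suc i * (suc k C suc i))  ≡⟨ xy∙z≈y∙xz (suc i) (suc n C suc k) (suc k C suc i) ⟨
  suc i * (suc n C suc k) * (suc k C suc i)    ≡⟨ *-assoc (suc i) (suc n C suc k) _ ⟩
  suc i * ((suc n C suc k) * (suc k C suc i))  ∎)
  where open ∣-Reasoning

C-quotient : ∀ {n} j k → n ≡ suc j * k → n C suc j ≡ k * (pred n C j)
C-quotient {n} j k eq = *-cancelˡ-≡ _ _ (suc j) (begin
  suc j * (n C suc j)         ≡⟨ C-absorption n j ⟩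
  n * (pred n C j)            ≡⟨ cong (_* (pred n C j)) eq ⟩
  suc j * k * (pred n C j)    ≡⟨ *-assoc (suc j) k _ ⟩
  suc j * (k * (pred n C j))  ∎)
  where open ≡-Reasoning

-- Vanishing of L C 1, ..., L C x modulo m.

-- For nonzero `m` this is a finite form of `IsPeriod m x L`. Being a record, it lets unification
-- recover `m`, `x` and `L`.
record Vanish (m x L : ℕ) : Set where
  constructor vanishing
  field at : ∀ j → j < x → m ∣ L C suc j

open Vanish

module _ {m : ℕ} where

  vanish-pred : ∀ {x L} → Vanish m (suc x) L → Vanish m x L
  vanish-pred v .at j j<x = v .at j (m<n⇒m<1+n j<x)

  vanish-suc : ∀ {x L} → Vanish m x L → m ∣ L C suc x → Vanish m (suc x) L
  vanish-suc v m∣ .at j j<1+x with m<1+n⇒m<n∨m≡n j<1+x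
  ... | inj₁ j<x  = v .at j j<x
  ... | inj₂ refl = m∣

  vanish-∣ : ∀ {d x L} → d ∣ m → Vanish m x L → Vanish d x L
  vanish-∣ d∣m v .at j j<x = ∣-trans d∣m (v .at j j<x)

  -- In Vandermonde's sum of (n C (x - i)) (L C i), the terms with 1 ≤ i ≤ x are multiples of `m`;
  -- for `suc x` the last term `L C suc x` survives. Pascal's rule proves both by mutual recursion,
  -- and the witness `s` keeps the congruence an equation in ℕ.
  C-shift : ∀ x L → Vanish m x L → ∀ n → ∃[ s ] (n + L) C x ≡ n C x + s * m
  C-shift-suc : ∀ x L → Vanish m x L → ∀ n →
                ∃[ s ] (n + L) C suc x ≡ n C suc x + L C suc x + s * m

  C-shift zero    L v n = 0 , refl
  C-shift (suc x) L v n
    with s , eq ← C-shift-suc x L (vanish-pred v) n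
    with divides q eq′ ← v .at x ≤-refl = q + s , (begin
      (n + L) C suc x                  ≡⟨ eq ⟩
      n C suc x + L C suc x + s * m    ≡⟨ cong (λ u → n C suc x + u + s * m) eq′ ⟩
      n C suc x + q * m + s * m        ≡⟨ +-assoc (n C suc x) _ _ ⟩
      n C suc x + (q * m + s * m)      ≡⟨ cong (n C suc x +_) (*-distribʳ-+ m q s) ⟨
      n C suc x + (q + s) * m          ∎)
    where open ≡-Reasoning

  C-shift-suc x L v zero    = 0 , sym (+-identityʳ _)
  C-shift-suc x L v (suc n)
    with s , eq ← C-shift x L v n
    with t , eq′ ← C-shift-suc x L v n = s + t , (begin
      suc (n + L) C suc x
        ≡⟨ nCk+nC[k+1]≡[n+1]C[k+1] (n + L) x ⟨
      (n + L) C x + (n + L) C suc x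
        ≡⟨ cong₂ _+_ eq eq′ ⟩
      n C x + s * m + (n C suc x + L C suc x + t * m)
        ≡⟨ +-collect (n C x) (n C suc x) (L C suc x) s t m ⟩
      n C x + n C suc x + L C suc x + (s + t) * m
        ≡⟨ cong (λ u → u + L C suc x + (s + t) * m) (nCk+nC[k+1]≡[n+1]C[k+1] n x) ⟩
      suc n C suc x + L C suc x + (s + t) * m ∎)
    where open ≡-Reasoning

  -- Shifting by `L` changes `n C suc j` only by a multiple of `m`. This closure under subtraction
  -- drives the division with remainder in `vanish⇒minimal∣`.
  vanish-+-cancelʳ : ∀ {x} n L → Vanish m x (n + L) → Vanish m x L → Vanish m x n
  vanish-+-cancelʳ {x} n L v+ v .at j j<x
    with s , eq ← C-shift (suc j) L (vanishing λ i i≤j → v .at i (<-≤-trans i≤j j<x)) n =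
    ∣m+n∣m⇒∣n (subst (m ∣_) (trans eq (+-comm (n C suc j) (s * m))) (v+ .at j j<x)) (n∣m*n s)

  -- Starting from 0, each of the `k` shifts by `L` contributes `L C suc x` modulo `m`. Hence the
  -- additive order of `L C suc x` decides which multiples of `L` also work for `suc x`.
  C-multiple : ∀ x L → Vanish m x L → ∀ k → ∃[ s ] (k * L) C suc x ≡ k * (L C suc x) + s * m
  C-multiple x L v zero    = 0 , refl
  C-multiple x L v (suc k)
    with s , eq ← C-multiple x L v k
    with t , eq′ ← C-shift-suc x L v (k * L) = s + t , (begin
      (L + k * L) C suc x                        ≡⟨ cong (_C suc x) (+-comm L (k * L)) ⟩
      (k * L + L) C suc x                        ≡⟨ eq′ ⟩
      (k * L) C suc x + L C suc x + t * m        ≡⟨ cong (λ u → u + L C suc x + t * m) eq ⟩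
      k * (L C suc x) + s * m + L C suc x + t * m  ≡⟨ *-collect k (L C suc x) s t m ⟩
      suc k * (L C suc x) + (s + t) * m          ∎)
    where open ≡-Reasoning

  ∣-C-multiple : ∀ x L → Vanish m x L → ∀ k → m ∣ k * (L C suc x) → m ∣ (k * L) C suc x
  ∣-C-multiple x L v k m∣ with s , eq ← C-multiple x L v k =
    subst (m ∣_) (sym eq) (∣m∣n⇒∣m+n m∣ (n∣m*n s))

  C-multiple-∣ : ∀ x L → Vanish m x L → ∀ k → m ∣ (k * L) C suc x → m ∣ k * (L C suc x)
  C-multiple-∣ x L v k m∣ with s , eq ← C-multiple x L v k =
    ∣m+n∣m⇒∣n (subst (m ∣_) (trans eq (+-comm (k * (L C suc x)) (s * m))) m∣) (n∣m*n s)

  vanish-multiple : ∀ {x} L → Vanish m x L → ∀ k → Vanish m x (k * L)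
  vanish-multiple L v k .at j j<x =
    ∣-C-multiple j L (vanishing λ i i<j → v .at i (<-trans i<j j<x)) k (∣n⇒∣m*n k (v .at j j<x))

-- Periods and minimal periods modulo m.

module _ (m : ℕ) .{{_ : NonZero m}} where

  +-cancelˡ-mod : ∀ {a b c d} → a ≡ c [mod m ] → a + b ≡ c + d [mod m ] → b ≡ d [mod m ]
  +-cancelˡ-mod {a} {b} {c} {d} a≡c a+b≡c+d = begin
    b % m                         ≡⟨ m*n+b≡b b ⟨
    (z + (a + b)) % m             ≡⟨ %-distribˡ-+ z (a + b) m ⟩
    (z % m + (a + b) % m) % m     ≡⟨ cong (λ u → (z % m + u) % m) a+b≡c+d ⟩
    (z % m + (c + d) % m) % m     ≡⟨ %-distribˡ-+ z (c + d) m ⟨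
    (z + (c + d)) % m             ≡⟨ cong (_% m) (swap c d) ⟩
    (c + (z + d)) % m             ≡⟨ %-distribˡ-+ c (z + d) m ⟩
    (c % m + (z + d) % m) % m     ≡⟨ cong (λ u → (u + (z + d) % m) % m) a≡c ⟨
    (a % m + (z + d) % m) % m     ≡⟨ %-distribˡ-+ a (z + d) m ⟨
    (a + (z + d)) % m             ≡⟨ cong (_% m) (swap a d) ⟨
    (z + (a + d)) % m             ≡⟨ m*n+b≡b d ⟩
    d % m                         ∎
    where
    open ≡-Reasoning
    -- `z` acts as the negative of `a` modulo `m`, since `z + a` equals `m * a`.
    z = pred m * a
    swap : ∀ u v → z + (u + v) ≡ u + (z + v)
    swap u v = trans (sym (+-assoc z u v)) (trans (cong (_+ v) (+-comm z u)) (+-assoc u z v))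
    m*n+b≡b : ∀ u → (z + (a + u)) % m ≡ u % m
    m*n+b≡b u = begin
      (z + (a + u)) % m      ≡⟨ cong (_% m) (+-assoc z a u) ⟨
      (z + a + u) % m        ≡⟨ cong (λ v → (v + u) % m) (+-comm z a) ⟩
      (suc (pred m) * a + u) % m ≡⟨ cong (λ v → (v * a + u) % m) (suc-pred m) ⟩
      (m * a + u) % m        ≡⟨ %-remove-+ˡ u (m∣m*n a) ⟩
      u % m                  ∎

  -- By Pascal's rule, the congruence for `x` at `n` is the difference of those for `suc x` at
  -- `suc n` and at `n`.
  isPeriod-pred : ∀ x L → IsPeriod m (suc x) L → IsPeriod m x L
  isPeriod-pred x L per n 1≤n = +-cancelˡ-mod (per n 1≤n) (begin
    ((n + L) C suc x + (n + L) C x) % m   ≡⟨ cong (_% m) (+-comm ((n + L) C suc x) _) ⟩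
    ((n + L) C x + (n + L) C suc x) % m   ≡⟨ cong (_% m) (nCk+nC[k+1]≡[n+1]C[k+1] (n + L) x) ⟩
    (suc (n + L) C suc x) % m             ≡⟨ per (suc n) (s≤s z≤n) ⟩
    (suc n C suc x) % m                   ≡⟨ cong (_% m) (nCk+nC[k+1]≡[n+1]C[k+1] n x) ⟨
    (n C x + n C suc x) % m               ≡⟨ cong (_% m) (+-comm (n C x) _) ⟩
    (n C suc x + n C x) % m               ∎)
    where open ≡-Reasoning

  -- Once the lower coefficients vanish, shifting by `L` adds the constant `L C suc x`. Periodicity
  -- at 1, the least argument that `IsPeriod` covers, forces this constant to be 0 modulo `m`.
  isPeriod⇒vanish : ∀ x L → IsPeriod m x L → Vanish m x L
  isPeriod⇒vanish zero    L per .at _ ()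
  isPeriod⇒vanish (suc x) L per = vanish-suc v (m%n≡0⇒n∣m _ m (trans (
    +-cancelˡ-mod {1 C suc x} {d = 0} refl (begin
    (1 C suc x + L C suc x) % m             ≡⟨ %-remove-+ʳ _ (n∣m*n s) ⟨
    (1 C suc x + L C suc x + s * m) % m     ≡⟨ cong (_% m) (proj₂ shift) ⟨
    ((1 + L) C suc x) % m                   ≡⟨ per 1 ≤-refl ⟩
    (1 C suc x) % m                         ≡⟨ cong (_% m) (+-identityʳ (1 C suc x)) ⟨
    (1 C suc x + 0) % m                     ∎)) (n∣m⇒m%n≡0 0 m (m ∣0))))
    where
    open ≡-Reasoning
    v = isPeriod⇒vanish x L (isPeriod-pred x L per)
    shift = C-shift-suc x L v 1
    s = proj₁ shift

  vanish⇒isPeriod : ∀ x L → Vanish m x L → IsPeriod m x L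
  vanish⇒isPeriod x L v n _ with s , eq ← C-shift x L v n =
    trans (cong (_% m) eq) (%-remove-+ʳ _ (n∣m*n s))

  module _ {x L : ℕ} (isMin : IsMinimalPeriod m x L) where

    open IsMinimalPeriod isMin

    minimal-nonZero : NonZero L
    minimal-nonZero = >-nonZero positive

    minimal-vanish : Vanish m x L
    minimal-vanish = isPeriod⇒vanish x L isPeriod

    -- The remainder of `n` by `L` satisfies `Vanish` too, so by minimality it cannot be positive.
    vanish⇒minimal∣ : ∀ n → Vanish m x n → L ∣ n
    vanish⇒minimal∣ n v = m%n≡0⇒n∣m n L (remainder≡0 (n % L) (m%n<n n L) remainder-vanish)
      where
      instance
        L≢0 : NonZero L
        L≢0 = minimal-nonZero
      remainder-vanish : Vanish m x (n % L)
      remainder-vanish = vanish-+-cancelʳ (n % L) (n / L * L)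
        (subst (Vanish m x) (m≡m%n+[m/n]*n n L) v)
        (vanish-multiple L minimal-vanish (n / L))
      remainder≡0 : ∀ r → r < L → Vanish m x r → r ≡ 0
      remainder≡0 zero    _   _ = refl
      remainder≡0 (suc r) r<L w = contradiction
        (minimal (suc r) (s≤s z≤n) (vanish⇒isPeriod x (suc r) w)) (<⇒≱ r<L)

  -- The last two components make `d` the additive order of `L C suc x` modulo `m`. The quotient
  -- exists because a period for `suc x` is also one for `x`.
  minimal-ratio : ∀ {x L L′} → IsMinimalPeriod m x L → IsMinimalPeriod m (suc x) L′ →
                  ∃[ d ] L′ ≡ d * L × m ∣ d * (L C suc x) × (∀ k → m ∣ k * (L C suc x) → d ∣ k)
  minimal-ratio {x} {L} {L′} isMin isMin′ =
    d , eq , C-multiple-∣ x L v d (subst (λ u → m ∣ u C suc x) eq (v′ .at x ≤-refl)) , order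
    where
    v = minimal-vanish isMin
    v′ = minimal-vanish isMin′
    L∣L′ = vanish⇒minimal∣ isMin L′ (vanish-pred v′)
    d = quotient L∣L′
    eq = m∣n⇒n≡quotient*m L∣L′
    instance
      L≢0 : NonZero L
      L≢0 = minimal-nonZero isMin
    order : ∀ k → m ∣ k * (L C suc x) → d ∣ k
    order k m∣ = *-cancelʳ-∣ L (subst (_∣ k * L) eq (vanish⇒minimal∣ isMin′ (k * L)
      (vanish-suc (vanish-multiple L v k) (∣-C-multiple x L v k m∣))))

-- Binomial coefficients and prime divisors.

-- Modulo p, Pascal's rule reads pred n C j ≡ - (pred n C (j - 1)) for 1 ≤ j ≤ x.
vanish⇒∤pred : ∀ {p x} n .{{_ : NonZero n}} → p ≢ 1 → Vanish p x n →
               ∀ j → j ≤ x → ¬ p ∣ pred n C j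
vanish⇒∤pred n       p≢1 v zero    _   p∣1 = p≢1 (∣1⇒≡1 p∣1)
vanish⇒∤pred {p} (suc n) p≢1 v (suc j) j<x p∣ =
  vanish⇒∤pred (suc n) p≢1 v j (<⇒≤ j<x)
    (∣m+n∣m⇒∣n (subst (p ∣_) pascal (v .at j j<x)) p∣)
  where
  pascal : suc n C suc j ≡ n C suc j + n C j
  pascal = trans (sym (nCk+nC[k+1]≡[n+1]C[k+1] n j)) (+-comm (n C j) _)

-- Absorption turns `suc j` times the coefficient into `m * a` times another one; the factor `b`
-- supplies what is missing to cancel `suc j`.
∣*⇒∣*C : ∀ {j} m a b → suc j ∣ a * b → m ∣ b * ((m * a) C suc j)
∣*⇒∣*C {j} m a b (divides q eq) = divides (q * c′) (*-cancelˡ-≡ _ _ (suc j) (begin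
  suc j * (b * c)       ≡⟨ x∙yz≈y∙xz (suc j) b c ⟩
  b * (suc j * c)       ≡⟨ cong (b *_) (C-absorption (m * a) j) ⟩
  b * (m * a * c′)      ≡⟨ *-swap b m a c′ ⟩
  a * b * (c′ * m)      ≡⟨ cong (_* (c′ * m)) eq ⟩
  q * suc j * (c′ * m)  ≡⟨ *-rotate q (suc j) c′ m ⟩
  suc j * (q * c′ * m)  ∎))
  where
  open ≡-Reasoning
  c = (m * a) C suc j
  c′ = pred (m * a) C j

≢1⇒primeDivisor : ∀ n .{{_ : NonZero n}} → n ≢ 1 → ∃[ p ] Prime p × p ∣ n
≢1⇒primeDivisor n n≢1 with factorise n
... | record { factors = []     ; isFactorisation = eq } = contradiction eq n≢1
... | record { factors = p ∷ ps ; isFactorisation = eq ; factorsPrime = prime-p ∷ _ } =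
  p , prime-p , subst (p ∣_) (sym eq) (m∣m*n _)

module _ {p : ℕ} (prime-p : Prime p) where

  private
    instance
      p≢0 : NonZero p
      p≢0 = prime⇒nonZero prime-p

    1<p : 1 < p
    1<p = nonTrivial⇒n>1 p {{prime⇒nonTrivial prime-p}}

    p≢1 : p ≢ 1
    p≢1 refl = ¬prime[1] prime-p

  ∤∧∤⇒∤* : ∀ {a b} → ¬ p ∣ a → ¬ p ∣ b → ¬ p ∣ a * b
  ∤∧∤⇒∤* {a} {b} ∤a ∤b p∣ab with euclidsLemma a b prime-p p∣ab
  ... | inj₁ p∣a = ∤a p∣a
  ... | inj₂ p∣b = ∤b p∣b

  ∤⇒coprime-^ : ∀ {u} → ¬ p ∣ u → ∀ c → Coprime (p ^ c) u
  ∤⇒coprime-^ ∤u zero    (e∣1 , _) = ∣1⇒≡1 e∣1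
  ∤⇒coprime-^ ∤u (suc c) {e} (e∣p^c+1 , e∣u) =
    ∤⇒coprime-^ ∤u c (coprime-divisor {m = e} {n = p} coprime e∣p^c+1 , e∣u)
    where
    coprime : Coprime e p
    coprime (f∣e , f∣p) with prime⇒irreducible prime-p f∣p
    ... | inj₁ f≡1  = f≡1
    ... | inj₂ refl = contradiction (∣-trans f∣e e∣u) ∤u

  extractPower : ∀ n → .{{NonZero n}} → ∃[ e ] ∃[ k ] n ≡ p ^ e * k × ¬ p ∣ k
  extractPower = <-rec (λ n → .{{NonZero n}} → ∃[ e ] ∃[ k ] n ≡ p ^ e * k × ¬ p ∣ k) step
    where
    step : ∀ n → (∀ {i} → i < n → .{{NonZero i}} → ∃[ e ] ∃[ k ] i ≡ p ^ e * k × ¬ p ∣ k) →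
           .{{NonZero n}} → ∃[ e ] ∃[ k ] n ≡ p ^ e * k × ¬ p ∣ k
    step n rec with p ∣? n
    ... | no  p∤n = 0 , n , sym (*-identityˡ n) , p∤n
    ... | yes p∣n
      with e , k , eq , p∤k ← rec (quotient-< p∣n {{prime⇒nonTrivial prime-p}}) {{quotient≢0 p∣n}} =
      suc e , k , trans (m∣n⇒n≡m*quotient p∣n) (trans (cong (p *_) eq) (sym (*-assoc p (p ^ e) k))) , p∤k

  -- Below p ^ (c + 1) the p-part of every positive number divides p ^ c;
  -- b collects the prime-to-p parts.
  commonMultiple : ∀ c n → n < p ^ suc c → ∃[ b ] ¬ p ∣ b × (∀ j → j < n → suc j ∣ p ^ c * b)
  commonMultiple c zero    _ = 1 , (λ p∣1 → p≢1 (∣1⇒≡1 p∣1)) , λ _ ()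
  commonMultiple c (suc n) n<
    with b , p∤b , div ← commonMultiple c n (<-trans (n<1+n n) n<)
    with e , k , eq , p∤k ← extractPower (suc n) = b * k , ∤∧∤⇒∤* p∤b p∤k , div′
    where
    open ∣-Reasoning
    e≤c : e ≤ c
    e≤c = ≮⇒≥ λ c<e → <⇒≱ n< (≤-trans (^-monoʳ-≤ p c<e) (∣⇒≤ (subst (p ^ e ∣_) (sym eq) (m∣m*n k))))
    p^e∣p^c : p ^ e ∣ p ^ c
    p^e∣p^c = subst (λ u → p ^ e ∣ p ^ u) (m+[n∸m]≡n e≤c)
      (subst (p ^ e ∣_) (sym (^-distribˡ-+-* p e (c ∸ e))) (m∣m*n _))
    div′ : ∀ j → j < suc n → suc j ∣ p ^ c * (b * k)
    div′ j j<1+n with m<1+n⇒m<n∨m≡n j<1+n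
    ... | inj₁ j<n  = begin
      suc j            ∣⟨ div j j<n ⟩
      p ^ c * b        ∣⟨ m∣m*n k ⟩
      p ^ c * b * k    ≡⟨ *-assoc (p ^ c) b k ⟩
      p ^ c * (b * k)  ∎
    ... | inj₂ refl = begin
      suc n            ≡⟨ eq ⟩
      p ^ e * k        ∣⟨ *-pres-∣ p^e∣p^c (n∣m*n b) ⟩
      p ^ c * (b * k)  ∎

  -- Write `suc x` as `p ^ e * k` with `p` not dividing `k`. If k ≥ 2, then `p ^ e` is a lower index
  -- strictly between 0 and `suc x`, and its coefficient is `k` times x C (p ^ e - 1), a product of
  -- two numbers prime to `p`.
  vanish-self⇒power : ∀ x → 1 ≤ x → Vanish p x (suc x) → ∃[ c ] 1 ≤ c × suc x ≡ p ^ c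
  vanish-self⇒power x 1≤x v with extractPower (suc x)
  ... | e     , zero        , eq , p∤k = contradiction (p ∣0) p∤k
  ... | zero  , suc zero    , eq , p∤k = contradiction 1≤x (subst (λ u → ¬ 1 ≤ u) (sym (suc-injective eq)) λ ())
  ... | suc e , suc zero    , eq , p∤k = suc e , s≤s z≤n , trans eq (*-identityʳ _)
  ... | e     , suc (suc k) , eq , p∤k =
    contradiction (subst (p ∣_) (C-quotient j (suc (suc k)) eq′) (v .at j j<x))
      (∤∧∤⇒∤* p∤k (vanish⇒∤pred (suc x) p≢1 v j (<⇒≤ j<x)))
    where
    instance
      p^e≢0 : NonZero (p ^ e)
      p^e≢0 = m^n≢0 p e
    j = pred (p ^ e)
    eq′ : suc x ≡ suc j * suc (suc k)
    eq′ = trans eq (cong (_* suc (suc k)) (sym (suc-pred (p ^ e))))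
    j<x : j < x
    j<x = ≤-pred (subst (suc j <_) (sym eq′) (m<m*n (suc j) (suc (suc k)) (s≤s (s≤s z≤n))))

  -- The coefficient at lower index `p ^ c` equals `p * u` with `u` prime to `p`. The one at 1 is
  -- `p ^ suc c`, so `d` is coprime to `u` and must divide `p`.
  commonDivisor∣p : ∀ {d x} c → 1 ≤ x → suc x ≡ p ^ suc c → (∀ j → j < x → d ∣ suc x C suc j) → d ∣ p
  commonDivisor∣p {d} {x} c 1≤x eq d∣ =
    coprime-divisor {m = d} {n = u} coprime
      (subst (d ∣_) (trans (C-quotient j p (trans eq′ (*-comm p _))) (*-comm p u)) (d∣ j j<x))
    where
    instance
      p^c≢0 : NonZero (p ^ c)
      p^c≢0 = m^n≢0 p c
    j = pred (p ^ c)
    u = x C j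
    eq′ : suc x ≡ p * suc j
    eq′ = trans eq (cong (p *_) (sym (suc-pred (p ^ c))))
    j<x : j < x
    j<x = ≤-pred (subst (suc j <_) (trans (*-comm (suc j) p) (sym eq′)) (m<m*n (suc j) p 1<p))
    vanish : Vanish p x (suc x)
    -- Here `suc i` divides `p ^ c * b`, so `p` divides `b` times the coefficient, and `p` does not
    -- divide `b`.
    vanish .at i i<x with b , p∤b , div ← commonMultiple c x (subst (x <_) eq ≤-refl)
      with euclidsLemma b _ prime-p (∣*⇒∣*C p (p ^ c) b (div i i<x))
    ... | inj₁ p∣b = contradiction p∣b p∤b
    ... | inj₂ p∣C = subst (λ n → p ∣ n C suc i) (sym eq) p∣C
    coprime : Coprime d u
    coprime (e∣d , e∣u) =
      ∤⇒coprime-^ (vanish⇒∤pred (suc x) p≢1 vanish j (<⇒≤ j<x)) (suc c)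
        (subst (_ ∣_) (trans (nC1≡n (suc x)) eq) (∣-trans e∣d (d∣ 0 1≤x)) , e∣u)

  -- Otherwise the multiple `N` of `L` would satisfy m ∣ N C suc x, say with quotient `q`.
  -- Absorption and cancellation of `m * p ^ c` then give `p * q ≡ b * u`, although `p` divides
  -- neither `b` nor `u`.
  minimal∤ : ∀ {m x L} .{{_ : NonZero m}} c → IsMinimalPeriod m x L →
             p ∣ m → suc x ≡ p ^ suc c → ¬ m ∣ L C suc x
  minimal∤ {m} {x} {L} c isMin p∣m eq m∣LC
    with b , p∤b , div ← commonMultiple c x (subst (x <_) eq ≤-refl) =
    ∤∧∤⇒∤* p∤b (vanish⇒∤pred N p≢1 (vanish-∣ p∣m vanish) x ≤-refl) (divides q (begin
      b * u      ≡⟨ *-cancelˡ-≡ _ _ (m * p ^ c) cancelled ⟨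
      p * q      ≡⟨ *-comm p q ⟩
      q * p      ∎))
    where
    open ≡-Reasoning
    instance
      b≢0 : NonZero b
      b≢0 = ≢-nonZero λ { refl → p∤b (p ∣0) }
      p^c≢0 : NonZero (p ^ c)
      p^c≢0 = m^n≢0 p c
      mp^c≢0 : NonZero (m * p ^ c)
      mp^c≢0 = m*n≢0 m (p ^ c)
      p^cb≢0 : NonZero (p ^ c * b)
      p^cb≢0 = m*n≢0 (p ^ c) b
      N≢0 : NonZero (m * (p ^ c * b))
      N≢0 = m*n≢0 m (p ^ c * b)
    -- `p ^ c * b` is a common multiple of 1, ..., x with `p` not dividing `b`: enough for `x`, one
    -- factor `p` short for `suc x`.
    N = m * (p ^ c * b)
    u = pred N C x
    vanish : Vanish m x N
    vanish .at j j<x = subst (m ∣_) (*-identityˡ _)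
      (∣*⇒∣*C m (p ^ c * b) 1 (subst (suc j ∣_) (sym (*-identityʳ _)) (div j j<x)))
    m∣NC : m ∣ N C suc x
    m∣NC = subst (λ n → m ∣ n C suc x) (sym (m∣n⇒n≡quotient*m L∣N))
      (∣-C-multiple x L (minimal-vanish m isMin) (quotient L∣N) (∣n⇒∣m*n (quotient L∣N) m∣LC))
      where L∣N = vanish⇒minimal∣ m isMin N vanish
    q = quotient m∣NC
    cancelled : m * p ^ c * (p * q) ≡ m * p ^ c * (b * u)
    cancelled = begin
      m * p ^ c * (p * q)    ≡⟨ *-regroup m (p ^ c) p q ⟩
      p * p ^ c * (q * m)    ≡⟨ cong₂ _*_ eq (m∣n⇒n≡quotient*m m∣NC) ⟨
      suc x * (N C suc x)    ≡⟨ C-absorption N x ⟩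
      N * u                  ≡⟨ *-reassoc m (p ^ c) b u ⟩
      m * p ^ c * (b * u)    ∎

-- The ratio of consecutive minimal periods.

-- Arbitrary minimal periods and the form `suc x ≡ p ^ c` keep the argument free of the search
-- behind `ℓ` and of truncated subtraction.
minimalPeriods-step : ∀ {m x L L′} .{{_ : NonZero m}} → 1 ≤ x →
  IsMinimalPeriod m x L → IsMinimalPeriod m (suc x) L′ →
  (¬ (∃[ p ] ∃[ c ] (Prime p × p ∣ m × 1 ≤ c × suc x ≡ p ^ c)) → L′ ≡ L)
  ×
  (∀ p c → Prime p → p ∣ m → 1 ≤ c → suc x ≡ p ^ c → L′ ≡ p * L)
minimalPeriods-step {m} {x} {L} {L′} 1≤x isMin isMin′ =
  case minimal-ratio m isMin isMin′ of λ (d , L′≡dL , m∣dC , order) →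
    let open Ratio d L′≡dL m∣dC order in notPower , power
  where
  module Ratio (d : ℕ) (L′≡dL : L′ ≡ d * L) (m∣dC : m ∣ d * (L C suc x))
               (order : ∀ k → m ∣ k * (L C suc x) → d ∣ k) where
    instance
      d≢0 : NonZero d
      d≢0 = m*n≢0⇒m≢0 d {{subst NonZero L′≡dL (minimal-nonZero m isMin′)}}

    d≡1⇒m∣C : d ≡ 1 → m ∣ L C suc x
    d≡1⇒m∣C d≡1 = subst (m ∣_) (trans (cong (_* (L C suc x)) d≡1) (*-identityˡ _)) m∣dC

    d∣C : ∀ j → j < x → d ∣ suc x C suc j
    d∣C j j<x = order _ (∣-trans (minimal-vanish m isMin .at j j<x)
      (subst (L C suc j ∣_) (*-comm (L C suc x) _) (C∣C*C L (suc x) (suc j))))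

    notPower : ¬ (∃[ p ] ∃[ c ] (Prime p × p ∣ m × 1 ≤ c × suc x ≡ p ^ c)) → L′ ≡ L
    notPower ¬power with d ≟ 1
    ... | yes d≡1 = trans L′≡dL (trans (cong (_* L) d≡1) (*-identityˡ L))
    ... | no  d≢1 =
      let p , prime-p , p∣d = ≢1⇒primeDivisor d d≢1
          c , 1≤c , eq = vanish-self⇒power prime-p x 1≤x (vanishing λ j j<x → ∣-trans p∣d (d∣C j j<x))
      -- `order m` gives `d ∣ m`, so the prime divisor `p` of `d` divides `m`.
      in contradiction (p , c , prime-p , ∣-trans p∣d (order m (m∣m*n _)) , 1≤c , eq) ¬power

    power : ∀ p c → Prime p → p ∣ m → 1 ≤ c → suc x ≡ p ^ c → L′ ≡ p * L
    power p zero    _       _   ()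
    power p (suc c) prime-p p∣m _  eq
      with prime⇒irreducible prime-p (commonDivisor∣p prime-p c 1≤x eq d∣C)
    ... | inj₁ d≡1 = contradiction (d≡1⇒m∣C d≡1) (minimal∤ prime-p c isMin p∣m eq)
    ... | inj₂ d≡p = trans L′≡dL (cong (_* L) d≡p)

corollary2p9 : ∀ (m x : ℕ) .{{_ : NonZero m}} → 1 ≤ x →
    (¬ (∃[ p ] ∃[ c ] (Prime p × p ∣ m × 1 ≤ c × x ≡ p ^ c ∸ 1)) →
    ℓ m (x + 1) ≡ ℓ m x)
    ×
    (∀ p c → Prime p → p ∣ m → 1 ≤ c → x ≡ p ^ c ∸ 1 →
    ℓ m (x + 1) ≡ p * ℓ m x)
corollary2p9 m x 1≤x =
  (λ ¬power → proj₁ step λ (p , c , prime-p , p∣m , 1≤c , eq) →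
    ¬power (p , c , prime-p , p∣m , 1≤c , cong pred eq)) ,
  λ p c prime-p p∣m 1≤c eq → proj₂ step p c prime-p p∣m 1≤c
    -- `p ^ c` is positive, so subtracting 1 and adding it again returns `p ^ c`.
    (trans (cong suc eq) (suc-pred (p ^ c) {{m^n≢0 p c {{prime⇒nonZero prime-p}}}}))
  where
  step = minimalPeriods-step 1≤x (ℓ-isMinimalPeriod m x)
    (subst (λ y → IsMinimalPeriod m y (ℓ m (x + 1))) (+-comm x 1) (ℓ-isMinimalPeriod m (x + 1)))
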